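{- The ideal $\mathcal R$ on $\omega$ generated by the homogeneous sets in some fixed instance of the random graph on $\omega$ is not $\le_K$-homogeneous (in particular, it is not homogeneous).
   Context: An ideal on a set $X$ is a family of subsets of $X$ closed under finite unions and subsets, containing all finite subsets of $X$ and not containing $X$; $\mathcal I^+=\mathcal P(X)\setminus\mathcal I$. The random graph on $\omega$ is the (unique up to isomorphism) countable graph with vertex set $\omega$ such that for any two disjoint finite sets $U,V\subseteq\omega$ there is a vertex outside $U\cup V$ adjacent to all vertices of $U$ and to none of $V$. A set of vertices is homogeneous (in the graph) if it is a clique or an independent set. $\mathcal R$ consists of all subsets of finite unions of homogeneous sets. For ideals $\mathcal I$ on $X$ and $\mathcal K$ on $Y$, $\mathcal I\le_K\mathcal K$ (Katětov order) means that there is $f:Y\to X$ with $f^{ -1}[B]\in\mathcal K$ for all $B\in\mathcal I$; $\mathcal I$ and $\mathcal K$ are isomorphic if there is a bijection $f:Y\to X$ with $f^{ -1}[B]\in\mathcal K\iff B\in\mathcal I$. For $A\in\mathcal I^+$, $\mathcal I\restriction A=\{B\cap A:B\in\mathcal I\}$ (an ideal on $A$). An ideal $\mathcal I$ is homogeneous if $\mathcal I\restriction A$ is isomorphic to $\mathcal I$ for each $A\in\mathcal I^+$, and $\le_K$-homogeneous if $\mathcal I\restriction A\le_K\mathcal I$ and $\mathcal I\le_K\mathcal I\restriction A$ for each $A\in\mathcal I^+$. -}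

module Defs where

open import Data.Empty using (⊥-elim)
open import Data.List.Base using (List; []; _∷_; foldr; map; _++_)
open import Data.List.Membership.Propositional using () renaming (_∈_ to _∈ₗ_; _∉_ to _∉ₗ_)
open import Data.List.Membership.Propositional.Properties using (∈-map⁺)
open import Data.List.Relation.Binary.Disjoint.Propositional using (Disjoint)
open import Data.List.Relation.Unary.All using (All; []; _∷_)
open import Data.List.Relation.Unary.All.Properties using (++⁺)
open import Data.List.Relation.Unary.Any using (here; there)
open import Data.Nat.Base using (ℕ)
open import Data.Product.Base using (Σ-syntax; ∃-syntax; _×_; _,_; proj₂)
open import Data.Refinement using (Refinement-syntax; value; _,_)
open import Data.Irrelevant using ([_])
open import Data.Sum.Base using (_⊎_; inj₁; inj₂; [_,_]′)
open import Function.Base using (_∘_)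
open import Function.Bundles using (_⇔_; _⤖_; module Bijection)
open import Level using (0ℓ) renaming (suc to lsuc)
open import Relation.Binary.Core using (Rel)
open import Relation.Binary.Definitions using (Symmetric)
open import Relation.Binary.PropositionalEquality using (_≡_; _≢_; refl)
open import Relation.Nullary.Negation using (¬_)
open import Relation.Unary using (Pred; _∈_; _∉_; _⊆_; _≐_; _∪_; _⊢_; ∅; U; ｛_｝)

Subset : Set → Set₁
Subset X = Pred X 0ℓ

Finite : {X : Set} → Subset X → Set
Finite {X} F = ∃[ xs ] F ≐ (λ x → x ∈ₗ xs)

record Ideal (X : Set) : Set (lsuc (lsuc 0ℓ)) where
  field
    Member   : Pred (Subset X) (lsuc 0ℓ)
    ⊆-closed : ∀ {A B} → A ⊆ B → B ∈ Member → A ∈ Member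
    ∪-closed : ∀ {A B} → A ∈ Member → B ∈ Member → A ∪ B ∈ Member
    finite   : ∀ {F} → Finite F → F ∈ Member
    proper   : U ∉ Member

open Ideal public using (Member)

infix 4 _∈ᴵ_ _∈⁺_

_∈ᴵ_ : {X : Set} → Subset X → Ideal X → Set₁
A ∈ᴵ 𝓘 = A ∈ Member 𝓘

_∈⁺_ : {X : Set} → Subset X → Ideal X → Set₁
A ∈⁺ 𝓘 = ¬ (A ∈ᴵ 𝓘)

-- A subset viewed as a set in its own right.  The membership proof is
-- irrelevant, so that an element of A is determined by its value.
⟦_⟧ : {X : Set} → Subset X → Set
⟦_⟧ {X} A = [ x ∈ X ∣ A x ]

-- Since A itself becomes the ambient set, B ∩ A is rendered as the preimage
-- of B under the inclusion value : ⟦ A ⟧ → X.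
restrict : {X : Set} (𝓘 : Ideal X) (A : Subset X) → A ∈⁺ 𝓘 → Ideal ⟦ A ⟧
restrict {X} 𝓘 A A∈⁺𝓘 = record
  { Member   = Trace
  ; ⊆-closed = λ { C⊆D (B , B∈𝓘 , D⊆B , _) → below B∈𝓘 (D⊆B ∘ C⊆D) }
  ; ∪-closed = λ { (B , B∈𝓘 , C⊆B , _) (B′ , B′∈𝓘 , D⊆B′ , _) →
                   below {B = B ∪ B′} (𝓘.∪-closed B∈𝓘 B′∈𝓘)
                     [ inj₁ ∘ C⊆B , inj₂ ∘ D⊆B′ ]′ }
  ; finite   = λ { (xs , F⊆xs , _) →
                   below {B = λ x → x ∈ₗ map value xs}
                     (𝓘.finite (map value xs , (λ p → p) , λ p → p))
                     (∈-map⁺ value ∘ F⊆xs) }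
  ; proper   = λ { (B , B∈𝓘 , U⊆B , _) →
                   A∈⁺𝓘 (𝓘.⊆-closed (λ {x} x∈A → U⊆B {x , [ x∈A ]} _) B∈𝓘) }
  }
  where
  module 𝓘 = Ideal 𝓘

  Trace : Pred (Subset ⟦ A ⟧) (lsuc 0ℓ)
  Trace C = ∃[ B ] B ∈ᴵ 𝓘 × C ≐ (value ⊢ B)

  below : ∀ {B C} → B ∈ᴵ 𝓘 → C ⊆ (value ⊢ B) → C ∈ Trace
  below {B} {C} B∈𝓘 C⊆B
    = (λ x → Σ[ y ∈ ⟦ A ⟧ ] value y ≡ x × C y)
    , 𝓘.⊆-closed (λ { (y , refl , y∈C) → C⊆B y∈C }) B∈𝓘
    , (λ {y} y∈C → y , refl , y∈C)
    , λ { (y , refl , y∈C) → y∈C }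

infix 4 _≤ᴷ_ _≅_

_≤ᴷ_ : {X Y : Set} → Ideal X → Ideal Y → Set₁
_≤ᴷ_ {X} {Y} 𝓘 𝓚 =
  Σ[ f ∈ (Y → X) ] (∀ B → B ∈ᴵ 𝓘 → (f ⊢ B) ∈ᴵ 𝓚)

_≅_ : {X Y : Set} → Ideal X → Ideal Y → Set₁
_≅_ {X} {Y} 𝓘 𝓚 =
  Σ[ f ∈ (Y ⤖ X) ] (∀ B → (Bijection.to f ⊢ B) ∈ᴵ 𝓚 ⇔ B ∈ᴵ 𝓘)

Homogeneous : {X : Set} → Ideal X → Set₁
Homogeneous 𝓘 = ∀ A (A∈⁺𝓘 : A ∈⁺ 𝓘) → restrict 𝓘 A A∈⁺𝓘 ≅ 𝓘

≤ᴷ-Homogeneous : {X : Set} → Ideal X → Set₁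
≤ᴷ-Homogeneous 𝓘 = ∀ A (A∈⁺𝓘 : A ∈⁺ 𝓘) →
  (restrict 𝓘 A A∈⁺𝓘 ≤ᴷ 𝓘) × (𝓘 ≤ᴷ restrict 𝓘 A A∈⁺𝓘)

record Graph (V : Set) : Set₁ where
  infix 4 _~_
  field
    _~_      : Rel V 0ℓ
    ~-irrefl : ∀ {x} → ¬ (x ~ x)
    ~-sym    : Symmetric _~_

⋃ : {V : Set} → List (Subset V) → Subset V
⋃ = foldr _∪_ ∅

module _ {V : Set} (G : Graph V) where
  open Graph G

  Clique : Subset V → Set
  Clique H = ∀ {x y} → x ∈ H → y ∈ H → x ≢ y → x ~ y

  Independent : Subset V → Set
  Independent H = ∀ {x y} → x ∈ H → y ∈ H → ¬ (x ~ y)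

  HomogeneousSet : Subset V → Set
  HomogeneousSet H = Clique H ⊎ Independent H

  -- Lists serve as the finite sets of vertices.
  Extends : List V → List V → Subset V
  Extends us vs x =
    x ∉ₗ us × x ∉ₗ vs × (∀ {u} → u ∈ₗ us → x ~ u) × (∀ {v} → v ∈ₗ vs → ¬ (x ~ v))

  IsRandom : Set
  IsRandom = ∀ us vs → Disjoint us vs → ∃[ x ] x ∈ Extends us vs

  CoveredByHomogeneous : Pred (Subset V) (lsuc 0ℓ)
  CoveredByHomogeneous B = ∃[ Hs ] All HomogeneousSet Hs × B ⊆ ⋃ Hs

module _ (G : Graph ℕ) (random : IsRandom G) where
  open Graph G

  private
    ⋃-++ˡ : ∀ (Hs : List (Subset ℕ)) {Ks} → ⋃ Hs ⊆ ⋃ (Hs ++ Ks)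
    ⋃-++ˡ (H ∷ Hs) (inj₁ x∈H)  = inj₁ x∈H
    ⋃-++ˡ (H ∷ Hs) (inj₂ x∈Hs) = inj₂ (⋃-++ˡ Hs x∈Hs)

    ⋃-++ʳ : ∀ (Hs : List (Subset ℕ)) {Ks} → ⋃ Ks ⊆ ⋃ (Hs ++ Ks)
    ⋃-++ʳ []       x∈Ks = x∈Ks
    ⋃-++ʳ (H ∷ Hs) x∈Ks = inj₂ (⋃-++ʳ Hs x∈Ks)

    singleton-clique : ∀ (x : ℕ) → Clique G ｛ x ｝
    singleton-clique x refl refl x≢x = ⊥-elim (x≢x refl)

    singletons : ∀ xs → All (HomogeneousSet G) (map ｛_｝ xs)
    singletons []       = []
    singletons (x ∷ xs) = inj₁ (singleton-clique x) ∷ singletons xs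

    ∈⇒∈⋃ : ∀ {x : ℕ} xs → x ∈ₗ xs → x ∈ ⋃ (map ｛_｝ xs)
    ∈⇒∈⋃ (y ∷ xs) (here refl)  = inj₁ refl
    ∈⇒∈⋃ (y ∷ xs) (there x∈xs) = inj₂ (∈⇒∈⋃ xs x∈xs)

    -- If some x in Extends us vs lies in a clique H, then no element of
    -- Extends us (x ∷ vs) lies in H; dually for an independent set.
    not-covered : ∀ (us vs : List ℕ) → Disjoint us vs → ∀ Hs → All (HomogeneousSet G) Hs →
                  ¬ (Extends G us vs ⊆ ⋃ Hs)
    not-covered us vs us#vs [] [] cover = cover (proj₂ (random us vs us#vs))
    not-covered us vs us#vs (H ∷ Hs) (hom ∷ homs) cover =
      not-covered us vs us#vs Hs homs λ x∈E →
        [ (λ x∈H → ⊥-elim (miss hom x∈E x∈H)) , (λ x∈Hs → x∈Hs) ]′ (cover x∈E)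
      where
      miss : HomogeneousSet G H → ∀ {x} → x ∈ Extends G us vs → x ∉ H
      miss (inj₁ clique) {x} (x∉us , _) x∈H =
        not-covered us (x ∷ vs)
          (λ { (v∈us , here refl) → x∉us v∈us ; (v∈us , there v∈vs) → us#vs (v∈us , v∈vs) })
          Hs homs
          λ { (y∉us , y∉vs , y~us , y≁vs) →
            [ (λ y∈H → ⊥-elim (y≁vs (here refl) (clique y∈H x∈H (y∉vs ∘ here))))
            , (λ y∈Hs → y∈Hs)
            ]′ (cover (y∉us , y∉vs ∘ there , y~us , y≁vs ∘ there)) }
      miss (inj₂ indep) {x} (_ , x∉vs , _) x∈H =
        not-covered (x ∷ us) vs
          (λ { (here refl , v∈vs) → x∉vs v∈vs ; (there v∈us , v∈vs) → us#vs (v∈us , v∈vs) })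
          Hs homs
          λ { (y∉us , y∉vs , y~us , y≁vs) →
            [ (λ y∈H → ⊥-elim (indep y∈H x∈H (y~us (here refl))))
            , (λ y∈Hs → y∈Hs)
            ]′ (cover (y∉us ∘ there , y∉vs , y~us ∘ there , y≁vs)) }

  𝓡 : Ideal ℕ
  𝓡 = record
    { Member   = CoveredByHomogeneous G
    ; ⊆-closed = λ { A⊆B (Hs , homs , B⊆Hs) → Hs , homs , B⊆Hs ∘ A⊆B }
    ; ∪-closed = λ { (Hs , homs , A⊆Hs) (Ks , homs′ , B⊆Ks) →
                     Hs ++ Ks , ++⁺ homs homs′
                     , [ ⋃-++ˡ Hs ∘ A⊆Hs , ⋃-++ʳ Hs ∘ B⊆Ks ]′ }
    ; finite   = λ { (xs , F⊆xs , _) →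
                     map ｛_｝ xs , singletons xs , ∈⇒∈⋃ xs ∘ F⊆xs }
    ; proper   = λ { (Hs , homs , U⊆Hs) →
                     not-covered [] [] (λ { (() , _) }) Hs homs (λ _ → U⊆Hs _) }
    }

{-# OPTIONS --safe #-}

-- The inclusion of any positive set A into ω witnesses 𝓡 ≤ᴷ 𝓡 ↾ A, so one has
-- to find A with 𝓡 ↾ A ≰ᴷ 𝓡.  Let A induce the disjoint union of infinitely
-- many infinite cliques.  Given a Katětov reduction f : ω → A, the points x for
-- which f x is adjacent to a given f y form a set in 𝓡, since neighbourhoods in
-- A are cliques.  Sets of the form Extends us vs are not in 𝓡, so there is a
-- second sequence X inducing the same graph as A such that, moreover, f sends
-- no two points of X to adjacent vertices.  Then f[X] is independent, whereas
-- its preimage contains the positive set X.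
--
-- Constructively, the existence of suitable points holds only up to double
-- negation.  The sequences are therefore given by a predicate that picks the
-- least suitable vertex at each stage, so that no choice is needed to name
-- their ranges.
module Submission where

open import Defs
open import Data.Empty using (⊥; ⊥-elim)
open import Data.List.Base using (List; []; _∷_; map; filter)
open import Data.List.Extrema.Nat using (max; xs≤max)
open import Data.List.Membership.Propositional using () renaming (_∈_ to _∈ₗ_; _∉_ to _∉ₗ_)
open import Data.List.Membership.Propositional.Properties using (∈-map⁺; ∈-map∘filter⁺; ∈-map∘filter⁻)
open import Data.List.Relation.Binary.Disjoint.Propositional using (Disjoint)
open import Data.List.Relation.Unary.All using (All; []; _∷_; lookup; tabulate)
open import Data.List.Relation.Unary.Any using (here; there)
open import Data.Nat.Base using (ℕ; zero; suc; _<_; s≤s)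
open import Data.Nat.Binary.Base using (ℕᵇ; zero; 2[1+_]; 1+[2_]; fromℕ; toℕ)
open import Data.Nat.Binary.Properties using (fromℕ-toℕ; toℕ-fromℕ)
open import Data.Nat.Induction using (<-rec)
open import Data.Nat.Properties using (<-cmp; <-irrefl; _≟_; m≤n⇒m<n∨m≡n)
open import Data.Product.Base using (∃-syntax; _×_; _,_; proj₁; proj₂; map₁)
open import Data.Irrelevant using ([_])
open import Data.Refinement using (value; _,_)
open import Data.Sum.Base using (inj₁; inj₂; [_,_]′)
open import Function.Base using (_∘_)
open import Function.Bundles using (Equivalence; module Bijection)
open import Level using (Level; 0ℓ)
open import Relation.Binary.Core using (Rel)
open import Relation.Binary.Definitions using (Symmetric; tri<; tri≈; tri>)
open import Relation.Binary.PropositionalEquality using (_≡_; _≢_; refl; sym; trans; cong; subst)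
open import Relation.Nullary.Decidable using (Dec; yes; no; ¬¬-excluded-middle; ¬?)
open import Relation.Nullary.Negation using (¬_; contradiction; contradiction-irr)
open import Relation.Unary using (_∈_; _∉_; _⊢_; _⊆_)

-- Double negation, least witnesses, and a splitting of ω into infinitely many infinite columns.

private
  variable
    a b : Level

  _>>=_ : {A : Set a} {B : Set b} → ¬ ¬ A → (A → ¬ ¬ B) → ¬ ¬ B
  (¬¬a >>= f) ¬b = ¬¬a λ a → f a ¬b

  pure : {A : Set a} → A → ¬ ¬ A
  pure a ¬a = ¬a a

  fresh : ∀ xs → ∃[ n ] n ∉ₗ xs
  fresh xs = suc (max 0 xs) , λ n∈xs → <-irrefl refl (lookup (xs≤max 0 xs) n∈xs)

  Least : Subset ℕ → Subset ℕ
  Least P n = P n × (∀ {m} → m < n → ¬ P m)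

  least-unique : ∀ {P m n} → Least P m → Least P n → m ≡ n
  least-unique {m = m} {n} (Pm , m-least) (Pn , n-least) with <-cmp m n
  ... | tri< m<n _ _ = contradiction Pm (n-least m<n)
  ... | tri≈ _ m≡n _ = m≡n
  ... | tri> _ _ n<m = contradiction Pn (m-least n<m)

  -- Without a least witness, strong induction refutes every `P n`.
  ¬¬-least : ∀ {P} → ¬ ¬ (∃[ n ] P n) → ¬ ¬ (∃[ n ] Least P n)
  ¬¬-least {P} ∃P no-least = ∃P λ (n , Pn) →
    <-rec (λ n → ¬ P n) (λ n below Pn → no-least (n , Pn , below)) n Pn

  -- n ↦ (column n , row n) is the splitting of a binary numeral into its number
  -- of trailing digits 1 and the rest (in bijective base 2).
  split : ℕᵇ → ℕ × ℕᵇ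
  split zero     = 0 , zero
  split 2[1+ x ] = 0 , x
  split 1+[2 x ] = map₁ suc (split x)

  join : ℕ → ℕᵇ → ℕᵇ
  join zero    x = 2[1+ x ]
  join (suc c) x = 1+[2 join c x ]

  split-join : ∀ c x → split (join c x) ≡ (c , x)
  split-join zero    x = refl
  split-join (suc c) x = cong (map₁ suc) (split-join c x)

  column row : ℕ → ℕ
  column = proj₁ ∘ split ∘ fromℕ
  row    = toℕ ∘ proj₂ ∘ split ∘ fromℕ

  column-infinite : ∀ c ns → ∃[ n ] n ∉ₗ ns × column n ≡ c
  column-infinite c ns with fresh (map row ns)
  ... | r , r∉ = n , (λ n∈ns → r∉ (subst (_∈ₗ map row ns) row-n (∈-map⁺ row n∈ns))) , cong proj₁ split-n
    where
    n : ℕ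
    n = toℕ (join c (fromℕ r))

    split-n : split (fromℕ n) ≡ (c , fromℕ r)
    split-n = trans (cong split (fromℕ-toℕ _)) (split-join c (fromℕ r))

    row-n : row n ≡ r
    row-n = trans (cong (toℕ ∘ proj₂) split-n) (toℕ-fromℕ r)

-- Positivity of extension sets and the greedy construction.

module _ (G : Graph ℕ) (random : IsRandom G) where
  open Graph G

  private
    module 𝓡 = Ideal (𝓡 G random)

  hom⇒∈𝓡 : ∀ {H} → HomogeneousSet G H → H ∈ᴵ 𝓡 G random
  hom⇒∈𝓡 hom = _ ∷ [] , hom ∷ [] , inj₁

  -- Should the point found for `Hs` lie in `H`, it becomes one more constraint: a nonneighbour of
  -- it escapes a clique, a neighbour of it escapes an independent set.
  Extends-positive : ∀ {Hs} → All (HomogeneousSet G) Hs → ∀ us vs → Disjoint us vs →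
                     ¬ ¬ (∃[ x ] x ∈ Extends G us vs × x ∉ ⋃ Hs)
  Extends-positive [] us vs us#vs = let x , x∈E = random us vs us#vs in pure (x , x∈E , λ ())
  Extends-positive {H ∷ Hs} (hom ∷ homs) us vs us#vs = do
    x , x∈E@(x∉us , x∉vs , _) , x∉Hs ← Extends-positive homs us vs us#vs
    yes x∈H ← ¬¬-excluded-middle {A = x ∈ H}
      where no x∉H → pure (x , x∈E , [ x∉H , x∉Hs ]′)
    second x∉us x∉vs x∈H hom
    where
    second : ∀ {x} → x ∉ₗ us → x ∉ₗ vs → x ∈ H → HomogeneousSet G H →
             ¬ ¬ (∃[ y ] y ∈ Extends G us vs × y ∉ ⋃ (H ∷ Hs))
    second {x} x∉us x∉vs x∈H (inj₁ clique) = do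
      y , (y∉us , y∉vs , y~us , y≁vs) , y∉Hs ← Extends-positive homs us (x ∷ vs)
        λ { (v∈us , here refl) → x∉us v∈us ; (v∈us , there v∈vs) → us#vs (v∈us , v∈vs) }
      pure ( y , (y∉us , y∉vs ∘ there , y~us , y≁vs ∘ there)
           , [ (λ y∈H → y≁vs (here refl) (clique y∈H x∈H (y∉vs ∘ here))) , y∉Hs ]′)
    second {x} x∉us x∉vs x∈H (inj₂ indep) = do
      y , (y∉us , y∉vs , y~us , y≁vs) , y∉Hs ← Extends-positive homs (x ∷ us) vs
        λ { (here refl , v∈vs) → x∉vs v∈vs ; (there v∈us , v∈vs) → us#vs (v∈us , v∈vs) }
      pure ( y , (y∉us ∘ there , y∉vs , y~us ∘ there , y≁vs)
           , [ (λ y∈H → indep y∈H x∈H (y~us (here refl))) , y∉Hs ]′)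

  -- A label (c , x) stands for the vertex x of column c; the columns of the
  -- greedy sequence are the cliques of the induced graph.
  module Greedy (Conflict : Rel ℕ 0ℓ) (conflict-sym : Symmetric Conflict)
                (conflict-∈𝓡 : ∀ y → Conflict y ∈ᴵ 𝓡 G random) where

    record Compatible (p q : ℕ × ℕ) : Set where
      constructor compatible
      private
        c = proj₁ p
        d = proj₁ q
        x = proj₂ p
        y = proj₂ q
      field
        distinct    : x ≢ y
        adjacent    : c ≡ d → x ~ y
        nonadjacent : c ≢ d → ¬ (x ~ y)
        no-conflict : ¬ Conflict x y

    open Compatible

    compatible-sym : Symmetric Compatible
    compatible-sym p∥q .distinct        = p∥q .distinct ∘ sym
    compatible-sym p∥q .adjacent        = ~-sym ∘ p∥q .adjacent ∘ sym
    compatible-sym p∥q .nonadjacent c≢d = p∥q .nonadjacent (c≢d ∘ sym) ∘ ~-sym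
    compatible-sym p∥q .no-conflict     = p∥q .no-conflict ∘ conflict-sym

    Fits : ℕ → List (ℕ × ℕ) → Subset ℕ
    Fits c s x = All (Compatible (c , x)) s

    data Prefix : ℕ → List (ℕ × ℕ) → Set where
      []  : Prefix 0 []
      _∷_ : ∀ {n s x} → Least (Fits (column n) s) x → Prefix n s →
            Prefix (suc n) ((column n , x) ∷ s)

    prefix-unique : ∀ {n s t} → Prefix n s → Prefix n t → s ≡ t
    prefix-unique []      []      = refl
    prefix-unique (x ∷ s) (y ∷ t) with prefix-unique s t
    ... | refl with least-unique x y
    ... | refl = refl

    -- Makes the required neighbours and nonneighbours of a new vertex disjoint.
    one-label : ∀ {n s c d y} → Prefix n s → (c , y) ∈ₗ s → (d , y) ∈ₗ s → c ≡ d
    one-label (x ∷ s)          (here refl) (here refl) = refl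
    one-label ((fits , _) ∷ s) (here refl) (there q∈s) = contradiction refl (lookup fits q∈s .distinct)
    one-label ((fits , _) ∷ s) (there p∈s) (here refl) = contradiction refl (lookup fits p∈s .distinct)
    one-label (x ∷ s)          (there p∈s) (there q∈s) = one-label s p∈s q∈s

    ⋃-conflict-∈𝓡 : ∀ (s : List (ℕ × ℕ)) →
                    ∃[ B ] B ∈ᴵ 𝓡 G random × (∀ {c y} → (c , y) ∈ₗ s → Conflict y ⊆ B)
    ⋃-conflict-∈𝓡 []            = (λ _ → ⊥) , ([] , [] , λ ()) , λ ()
    ⋃-conflict-∈𝓡 ((c , y) ∷ s) =
      let B , B∈𝓡 , B-covers = ⋃-conflict-∈𝓡 s
      in _ , 𝓡.∪-closed (conflict-∈𝓡 y) B∈𝓡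
           , λ { (here refl) → inj₁ ; (there q∈s) → inj₂ ∘ B-covers q∈s }

    -- `us` holds the vertices of `s` in column `c`, `vs` the others. All conflicts with `s` lie in
    -- one set of the ideal, which cannot cover `Extends G us vs`.
    fits-exists : ∀ {n s} c → Prefix n s → ¬ ¬ (∃[ x ] Fits c s x)
    fits-exists {s = s} c pre = do
      x , (x∉us , x∉vs , x~us , x≁vs) , x∉Hs ← Extends-positive homs us vs us#vs
      let fit : ∀ {p} → p ∈ₗ s → Compatible (c , x) p
          fit {d , y} p∈s = case-column p∈s x∉us x∉vs x~us x≁vs (x∉Hs ∘ B⊆Hs ∘ covers p∈s ∘ conflict-sym)
      pure (x , tabulate fit)
      where
      same? : ∀ (p : ℕ × ℕ) → Dec (c ≡ proj₁ p)
      same? p = c ≟ proj₁ p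

      us vs : List ℕ
      us = map proj₂ (filter same? s)
      vs = map proj₂ (filter (¬? ∘ same?) s)

      us#vs : Disjoint us vs
      us#vs (u∈us , u∈vs) with ∈-map∘filter⁻ proj₂ same? u∈us | ∈-map∘filter⁻ proj₂ (¬? ∘ same?) u∈vs
      ... | _ , p∈s , refl , c≡d | _ , q∈s , refl , c≢e = c≢e (trans c≡d (one-label pre p∈s q∈s))

      bounded = ⋃-conflict-∈𝓡 s
      homs    = proj₁ (proj₂ (proj₁ (proj₂ bounded)))
      B⊆Hs    = proj₂ (proj₂ (proj₁ (proj₂ bounded)))
      covers  = proj₂ (proj₂ bounded)

      case-column : ∀ {x d y} → (d , y) ∈ₗ s → x ∉ₗ us → x ∉ₗ vs → (∀ {u} → u ∈ₗ us → x ~ u) →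
                    (∀ {v} → v ∈ₗ vs → ¬ (x ~ v)) → ¬ Conflict x y → Compatible (c , x) (d , y)
      case-column {d = d} p∈s x∉us x∉vs x~us x≁vs ok with c ≟ d
      ... | yes c≡d = compatible (λ { refl → x∉us y∈us }) (λ _ → x~us y∈us) (contradiction c≡d) ok
        where y∈us = ∈-map∘filter⁺ proj₂ same? (_ , p∈s , refl , c≡d)
      ... | no  c≢d = compatible (λ { refl → x∉vs y∈vs }) (⊥-elim ∘ c≢d) (λ _ → x≁vs y∈vs) ok
        where y∈vs = ∈-map∘filter⁺ proj₂ (¬? ∘ same?) (_ , p∈s , refl , c≢d)

    prefix-exists : ∀ n → ¬ ¬ (∃[ s ] Prefix n s)
    prefix-exists zero    = pure ([] , [])
    prefix-exists (suc n) = do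
      s , pre ← prefix-exists n
      x , x-least ← ¬¬-least (fits-exists (column n) pre)
      pure (_ , x-least ∷ pre)

    Picks : ℕ → Subset ℕ
    Picks n x = ∃[ s ] Prefix n s × Least (Fits (column n) s) x

    picks-exists : ∀ n → ¬ ¬ (∃[ x ] Picks n x)
    picks-exists n = do
      s , pre ← prefix-exists n
      x , x-least ← ¬¬-least (fits-exists (column n) pre)
      pure (x , s , pre , x-least)

    picks-unique : ∀ {n x y} → Picks n x → Picks n y → x ≡ y
    picks-unique (s , pre , x-least) (t , pre′ , y-least) with prefix-unique pre pre′
    ... | refl = least-unique x-least y-least

    picks⇒∈prefix : ∀ {m n s x} → Picks m x → Prefix n s → m < n → (column m , x) ∈ₗ s
    picks⇒∈prefix p (y ∷ pre) (s≤s m≤n) with m≤n⇒m<n∨m≡n m≤n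
    ... | inj₁ m<n  = there (picks⇒∈prefix p pre m<n)
    ... | inj₂ refl with picks-unique p (_ , pre , y)
    ... | refl = here refl

    -- The label of the earlier stage belongs to the prefix that the later vertex was chosen to fit.
    picks-compatible : ∀ {m n x y} → m ≢ n → Picks m x → Picks n y →
                       Compatible (column m , x) (column n , y)
    picks-compatible {m} {n} m≢n p@(_ , pre , x-fits , _) q@(_ , pre′ , y-fits , _) with <-cmp m n
    ... | tri< m<n _ _ = compatible-sym (lookup y-fits (picks⇒∈prefix p pre′ m<n))
    ... | tri≈ _ m≡n _ = contradiction m≡n m≢n
    ... | tri> _ _ n<m = lookup x-fits (picks⇒∈prefix q pre n<m)

    picks-index : ∀ {m n x y} → Picks m x → Picks n y → x ≢ y → m ≢ n
    picks-index p q x≢y refl = x≢y (picks-unique p q)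

    ~⇒column≡ : ∀ {m n x y} → Picks m x → Picks n y → x ~ y → column m ≡ column n
    ~⇒column≡ {m} {n} p q x~y with column m ≟ column n
    ... | yes c≡d = c≡d
    ... | no  c≢d = contradiction x~y (picks-compatible (c≢d ∘ cong column) p q .nonadjacent c≢d)

    -- The graph induced on the range.

    Range : Subset ℕ
    Range x = ∃[ n ] Picks n x

    -- All neighbours of `u` in the range share its column, and a column is a clique.
    neighbours-clique : ∀ {u} → u ∈ Range → Clique G (λ v → v ∈ Range × v ~ u)
    neighbours-clique (_ , r) ((_ , p) , x~u) ((_ , q) , y~u) x≢y =
      picks-compatible (picks-index p q x≢y) p q .adjacent
        (trans (~⇒column≡ p r x~u) (sym (~⇒column≡ q r y~u)))

    range-no-conflict : (∀ {x} → ¬ Conflict x x) → ∀ {x y} → x ∈ Range → y ∈ Range → ¬ Conflict x y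
    range-no-conflict conflict-irrefl (m , p) (n , q) with m ≟ n
    ... | no m≢n = picks-compatible m≢n p q .no-conflict
    ... | yes refl with picks-unique p q
    ... | refl = conflict-irrefl

    -- An independent set meets a column in at most one vertex, and a clique
    -- meets at most one column.
    infinite-column-uncovered : ∀ {Hs} → All (HomogeneousSet G) Hs → ∀ cs →
      ¬ ¬ (∃[ c ] c ∉ₗ cs × (∀ ns → ¬ ¬ (∃[ n ] ∃[ x ] n ∉ₗ ns × column n ≡ c × Picks n x × x ∉ ⋃ Hs)))
    infinite-column-uncovered [] cs = let c , c∉cs = fresh cs in pure (c , c∉cs , λ ns →
      let n , n∉ns , col-n = column-infinite c ns in do
      x , p ← picks-exists n
      pure (n , x , n∉ns , col-n , p , λ ()))
    infinite-column-uncovered {H ∷ Hs} (inj₁ clique ∷ homs) cs = do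
      c , c∉cs , uncovered ← infinite-column-uncovered homs cs
      yes (m , x , refl , p , x∈H) ← ¬¬-excluded-middle {A = ∃[ m ] ∃[ x ] column m ≡ c × Picks m x × x ∈ H}
        where no miss → pure (c , c∉cs , λ ns → do
                n , y , n∉ns , col-n , q , y∉Hs ← uncovered ns
                pure (n , y , n∉ns , col-n , q , [ (λ y∈H → miss (n , y , col-n , q , y∈H)) , y∉Hs ]′))
      -- `H` meets the column of `m`, hence misses every other column; the induction is asked again,
      -- now avoiding that column.
      d , d∉ , uncovered′ ← infinite-column-uncovered homs (column m ∷ cs)
      pure (d , d∉ ∘ there , λ ns → do
        n , y , n∉ns , col-n , q , y∉Hs ← uncovered′ ns
        let y∉H : y ∉ H
            y∉H y∈H =
              let d≢c = λ n≡m → d∉ (here (trans (sym col-n) n≡m))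
                  q∥p = picks-compatible (d≢c ∘ cong column) q p
              in q∥p .nonadjacent d≢c (clique y∈H x∈H (q∥p .distinct))
        pure (n , y , n∉ns , col-n , q , [ y∉H , y∉Hs ]′))
    infinite-column-uncovered {H ∷ Hs} (inj₂ indep ∷ homs) cs = do
      c , c∉cs , uncovered ← infinite-column-uncovered homs cs
      pure (c , c∉cs , λ ns → do
        m , x , m∉ns , refl , p , x∉Hs ← uncovered ns
        yes x∈H ← ¬¬-excluded-middle {A = x ∈ H}
          where no x∉H → pure (m , x , m∉ns , refl , p , [ x∉H , x∉Hs ]′)
        -- Excluding `m` yields a second vertex of the same column. It is adjacent to `x`, so it
        -- cannot lie in the independent `H`.
        n , y , n∉ , col-n , q , y∉Hs ← uncovered (m ∷ ns)
        pure (n , y , n∉ ∘ there , col-n , q ,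
          [ (λ y∈H → indep y∈H x∈H (picks-compatible (n∉ ∘ here) q p .adjacent col-n)) , y∉Hs ]′))

    range-positive : Range ∈⁺ 𝓡 G random
    range-positive (Hs , homs , R⊆Hs) = infinite-column-uncovered homs [] λ (_ , _ , uncovered) →
      uncovered [] λ (n , x , _ , _ , p , x∉Hs) → x∉Hs (R⊆Hs (n , p))

  -- The empty conflict relation leaves only the column structure: infinitely many infinite cliques
  -- without edges between them.
  open Greedy (λ _ _ → ⊥) (λ ()) (λ _ → [] , [] , λ ()) public
    using ()
    renaming (Range to Cliques; range-positive to cliques-positive; neighbours-clique to cliques-neighbours-clique)

  cliques-≰ᴷ : ¬ (restrict (𝓡 G random) Cliques cliques-positive ≤ᴷ 𝓡 G random)
  cliques-≰ᴷ (f , f-reduces) =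
    range-positive (𝓡.⊆-closed (λ {x} x∈X → x , x∈X , refl) (preimage-∈𝓡 {Image} (inj₂ image-independent)))
    where
    g : ℕ → ℕ
    g = value ∘ f

    preimage-∈𝓡 : ∀ {H} → HomogeneousSet G H → (g ⊢ H) ∈ᴵ 𝓡 G random
    preimage-∈𝓡 {H} hom = f-reduces (value ⊢ H) (H , hom⇒∈𝓡 hom , (λ h → h) , λ h → h)

    -- The membership proof carried by `f x` is irrelevant, so it can only be used to derive a
    -- contradiction.
    g-∈-cliques : ∀ x → ¬ ¬ (g x ∈ Cliques)
    g-∈-cliques x gx∉A with f x
    ... | _ , [ v∈A ] = contradiction-irr v∈A gx∉A

    -- Membership in Cliques is part of the conflict because it is only known up to
    -- double negation, while the clique property needs an actual proof of it.
    Conflict : Rel ℕ 0ℓ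
    Conflict x y = (g x ∈ Cliques × g y ∈ Cliques) × g y ~ g x

    -- `Conflict y` is by definition the `g`-preimage of the neighbours of `g y` in `Cliques`, taken
    -- to be empty unless `g y` is itself in `Cliques`; these form a clique.
    conflict-∈𝓡 : ∀ y → Conflict y ∈ᴵ 𝓡 G random
    conflict-∈𝓡 y = preimage-∈𝓡 {λ v → (g y ∈ Cliques × v ∈ Cliques) × v ~ g y} (inj₁
      λ ((u∈A , v∈A) , v~u) ((_ , w∈A) , w~u) → cliques-neighbours-clique u∈A (v∈A , v~u) (w∈A , w~u))

    open Greedy Conflict (λ ((p , q) , e) → (q , p) , ~-sym e) conflict-∈𝓡

    Image : Subset ℕ
    Image v = ∃[ x ] x ∈ Range × v ≡ g x

    image-independent : Independent G Image
    image-independent (x , x∈X , refl) (y , y∈X , refl) gx~gy =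
      g-∈-cliques x λ gx∈A → g-∈-cliques y λ gy∈A →
      range-no-conflict (~-irrefl ∘ proj₂) x∈X y∈X ((gx∈A , gy∈A) , ~-sym gx~gy)

≅⇒≤ᴷ : {X Y : Set} (𝓘 : Ideal X) (𝓚 : Ideal Y) → 𝓘 ≅ 𝓚 → 𝓘 ≤ᴷ 𝓚
≅⇒≤ᴷ _ _ (f , f-iso) = Bijection.to f , λ B → Equivalence.from (f-iso B)

proposition10p4 : (G : Graph ℕ) (random : IsRandom G) →
    ¬ (≤ᴷ-Homogeneous (𝓡 G random)) × ¬ (Homogeneous (𝓡 G random))
proposition10p4 G random =
    (λ hom → cliques-≰ᴷ G random (proj₁ (hom A A∈⁺𝓡)))
  , (λ hom → cliques-≰ᴷ G random (≅⇒≤ᴷ (restrict (𝓡 G random) A A∈⁺𝓡) (𝓡 G random) (hom A A∈⁺𝓡)))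
  where
  A     = Cliques G random
  A∈⁺𝓡 = cliques-positive G random
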